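{- Let $\mathrm{HTG}(m,n,\ell)$ be a honeycomb toroidal graph in normal form ($0\le \ell\le n/2$). Its girth is $6$, except in the following cases, in which its girth is $4$: (1) $n=4$; (2) $m=1$, $n>4$ and $\ell=3$; (3) $m=1$, $n>4$, $n\equiv 2\pmod 4$ and $\ell=n/2$; (4) $m=1$, $n>4$, $n\equiv 0\pmod 4$ and $\ell=(n-2)/2$; (5) $m=2$, $n>4$ and $\ell\in\{0,2\}$.
   Context: Honeycomb toroidal graph: let $m\ge 1$ be an integer, $n\ge 4$ an even integer, and $\ell$ an integer with $\ell\equiv m \pmod 2$. The graph $\mathrm{HTG}(m,n,\ell)$ has vertex set $\{u_{i,j}: 0\le i\le m-1,\ j\in\mathbb{Z}_n\}$ (second subscripts are taken modulo $n$; the vertices $u_{i,0},\dots,u_{i,n-1}$ form column $i$) and the following edges: vertical edges $u_{i,j}u_{i,j+1}$ for all $0\le i\le m-1$ and all $j$; flat edges $u_{i,j}u_{i+1,j}$ for $0\le i\le m-2$ and all $j$ with $i+j$ odd; jump edges $u_{m-1,j}u_{0,j+\ell}$ for all $j$ with $j\equiv m\pmod 2$. Only parameters for which this is a simple 3-regular graph are allowed (in particular, when $m=1$ one requires $\ell\not\equiv\pm1\pmod n$). The graph is in normal form if $0\le\ell\le n/2$. The girth is the length of a shortest cycle. -}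

module Defs where

open import Data.Fin using (Fin; toℕ)
open import Data.Integer using (ℤ; +_; _+_; _-_; 0ℤ; 1ℤ; _≤_)
open import Data.Integer.Divisibility.Signed using (_∣_)
open import Data.List using (List; length)
open import Data.List.Membership.Propositional using (_∈_)
open import Data.List.Relation.Unary.Unique.Propositional using (Unique)
open import Data.Nat as ℕ using (ℕ; suc)
open import Data.Nat.DivMod using (_/_; _%_)
open import Data.Product using (_×_; _,_; ∃-syntax)
open import Data.Sum using (_⊎_)
open import Function.Bundles using (_⇔_)
open import Level using (0ℓ)
open import Relation.Binary.Core using (Rel)
open import Relation.Binary.Construct.Closure.Symmetric using (SymClosure)
open import Relation.Binary.Definitions using (Irreflexive; Symmetric)
open import Relation.Binary.PropositionalEquality using (_≡_)
open import Function.Definitions using (Injective)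

infix 4 _≡_[mod_]

_≡_[mod_] : ℤ → ℤ → ℕ → Set
a ≡ b [mod k ] = + k ∣ (a - b)

module _ {V : Set} (_~_ : Rel V 0ℓ) where

  HasDegree : V → ℕ → Set
  HasDegree v d =
    ∃[ ns ] length ns ≡ d × Unique ns × (∀ w → (w ∈ ns) ⇔ (v ~ w))

  record IsSimpleRegular (d : ℕ) : Set where
    field
      symmetric : Symmetric _~_
      loopless  : Irreflexive _≡_ _~_
      regular   : ∀ v → HasDegree v d

  record Cycle (k : ℕ) : Set where
    field
      3≤k      : 3 ℕ.≤ k
      vertex   : Fin k → V
      distinct : Injective _≡_ _≡_ vertex
      step     : ∀ a b → toℕ b ≡ suc (toℕ a) → vertex a ~ vertex b
      close    : ∀ a b → suc (toℕ a) ≡ k → toℕ b ≡ 0 → vertex a ~ vertex b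

  record HasGirth (g : ℕ) : Set where
    field
      attained : Cycle g
      shortest : ∀ {k} → Cycle k → g ℕ.≤ k

Vertex : ℕ → ℕ → Set
Vertex m n = Fin m × Fin n

⟦_⟧ : ∀ {k} → Fin k → ℤ
⟦ i ⟧ = + toℕ i

-- The pair (i , j) is the vertex u_{i,j}; Fin n holds the canonical
-- representatives of ℤ_n.  Since n is even, the parity of a
-- representative does not depend on its choice.
data Edge (m n : ℕ) (ℓ : ℤ) : Rel (Vertex m n) 0ℓ where
  vertical : ∀ {i j j′} →
             ⟦ j′ ⟧ ≡ ⟦ j ⟧ + 1ℤ [mod n ] →
             Edge m n ℓ (i , j) (i , j′)
  flat     : ∀ {i i′ j} →
             toℕ i′ ≡ suc (toℕ i) →
             ⟦ i ⟧ + ⟦ j ⟧ ≡ 1ℤ [mod 2 ] →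
             Edge m n ℓ (i , j) (i′ , j)
  jump     : ∀ {i i′ j j′} →
             suc (toℕ i) ≡ m → toℕ i′ ≡ 0 →
             ⟦ j ⟧ ≡ + m [mod 2 ] →
             ⟦ j′ ⟧ ≡ ⟦ j ⟧ + ℓ [mod n ] →
             Edge m n ℓ (i , j) (i′ , j′)

HTG : (m n : ℕ) (ℓ : ℤ) → Rel (Vertex m n) 0ℓ
HTG m n ℓ = SymClosure (Edge m n ℓ)

-- The last field counts distinct neighbours, so it also rules out a jump
-- edge that is parallel to a vertical edge (m = 1 and ℓ ≡ ±1 modulo n):
-- there every vertex has only two neighbours.
record Admissible (m n : ℕ) (ℓ : ℤ) : Set where
  field
    1≤m    : 1 ℕ.≤ m
    4≤n    : 4 ℕ.≤ n
    n-even : n % 2 ≡ 0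
    parity : ℓ ≡ + m [mod 2 ]
    cubic  : IsSimpleRegular (HTG m n ℓ) 3

NormalForm : ℕ → ℤ → Set
NormalForm n ℓ = 0ℤ ≤ ℓ × ℓ ≤ + (n / 2)

-- The divisions by 2 are exact because n is even.
data Exceptional (m n : ℕ) (ℓ : ℤ) : Set where
  case₁ : n ≡ 4 → Exceptional m n ℓ
  case₂ : m ≡ 1 → 4 ℕ.< n → ℓ ≡ + 3 → Exceptional m n ℓ
  case₃ : m ≡ 1 → 4 ℕ.< n → n % 4 ≡ 2 → ℓ ≡ + (n / 2) → Exceptional m n ℓ
  case₄ : m ≡ 1 → 4 ℕ.< n → n % 4 ≡ 0 → ℓ ≡ + ((n ℕ.∸ 2) / 2) → Exceptional m n ℓ
  case₅ : m ≡ 2 → 4 ℕ.< n → ℓ ≡ + 0 ⊎ ℓ ≡ + 2 → Exceptional m n ℓ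

{-# OPTIONS --safe #-}

-- Colour u_{i,j} black when i + j is odd.  Every edge joins a black vertex to a white one, so all
-- cycles are even, and the flat or jump edge at a black vertex always leads to the next column
-- (cyclically).  A 4-cycle therefore consists of two black and two white vertices joined by four
-- steps, each of the form +1, -1 or "next column"; as a step is determined by either endpoint, only
-- a few patterns survive, and each of them forces a congruence for ℓ modulo n, which in normal form
-- is one of the exceptional cases.  Two adjacent columns (a single column and its own translate by ℓ
-- if m = 1) always carry a 6-cycle.
module Submission where

open import Defs
open import Data.Empty using (⊥; ⊥-elim)
open import Data.Fin using (Fin; zero; suc; toℕ; fromℕ<)
open import Data.Fin.Patterns using (0F; 1F; 2F; 3F; 4F)
open import Data.Fin.Properties using (toℕ-injective; toℕ<n; toℕ-fromℕ<)
open import Data.Integer using (ℤ; +_; +≤+; _+_; _-_; -_; _*_; 0ℤ; 1ℤ; ∣_∣; _◃_)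
open import Data.Integer.DivMod using (_%ℕ_; _/ℕ_; n%ℕd<d; a≡a%ℕn+[a/ℕn]*n)
open import Data.Integer.Divisibility.Signed using (_∣_; divides; _∣?_; ∣⇒∣ᵤ; ∣-trans; ∣m∣n⇒∣m+n; ∣m∣n⇒∣m-n; ∣m⇒∣-m)
import Data.Integer.Properties as ℤ
open import Data.Integer.Tactic.RingSolver using (solve-∀)
open import Data.List using ([]; _∷_)
open import Data.List.Relation.Unary.All using ([]; _∷_)
open import Data.List.Relation.Unary.AllPairs using ([]; _∷_)
open import Data.List.Relation.Unary.Any using (here; there)
open import Data.Nat as ℕ using (ℕ; zero; suc; NonZero; z≤n; s≤s)
open import Data.Nat.Divisibility as ℕ∣ using (>⇒∤; m%n≡0⇒n∣m)
open import Data.Nat.DivMod using (_%_; _/_; _mod_; m≡m%n+[m/n]*n; m%n<n; m*n/n≡m; [m+kn]%n≡m%n)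
import Data.Nat.Properties as ℕ
open import Data.Product using (_×_; _,_; ∃-syntax; proj₂)
open import Data.Sign using (Sign; opposite)
open import Data.Sum using (_⊎_; inj₁; inj₂)
open import Data.Vec using (Vec; []; _∷_; _∷ʳ_; lookup)
open import Data.Vec.Relation.Unary.All using ([]; _∷_)
open import Data.Vec.Relation.Unary.AllPairs using ([]; _∷_)
open import Data.Vec.Relation.Unary.Linked using (Linked; [-]; _∷_)
open import Data.Vec.Relation.Unary.Unique.Propositional using (Unique)
open import Data.Vec.Relation.Unary.Unique.Propositional.Properties using (lookup-injective)
open import Function using (_∘_; Equivalence)
open import Level using (0ℓ)
open import Relation.Binary.Construct.Closure.Symmetric using (fwd; bwd; symmetric)
open import Relation.Binary.Core using (Rel)
open import Relation.Binary.PropositionalEquality using (_≡_; _≢_; refl; sym; trans; ≢-sym; cong; cong₂; subst; module ≡-Reasoning)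
open import Relation.Nullary using (¬_; contradiction; yes; no)
open import Relation.Nullary.Decidable using (from-no)

-- Cycles presented as closed chains of vertices.

module _ {V : Set} {_~_ : Rel V 0ℓ} where

  linked-step : ∀ {k z} (xs : Vec V k) → Linked _~_ (xs ∷ʳ z) →
    ∀ a b → toℕ b ≡ suc (toℕ a) → lookup xs a ~ lookup xs b
  linked-step (x ∷ y ∷ xs) (x~y ∷ _) zero    (suc zero) _  = x~y
  linked-step (x ∷ xs)     (_ ∷ ls)  (suc a) (suc b)    eq =
    linked-step xs ls a b (ℕ.suc-injective eq)

  linked-last : ∀ {k z} (xs : Vec V k) → Linked _~_ (xs ∷ʳ z) →
    ∀ a → suc (toℕ a) ≡ k → lookup xs a ~ z
  linked-last (x ∷ [])     (x~z ∷ _) zero    _  = x~z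
  linked-last (x ∷ xs)     (_ ∷ ls)  (suc a) eq =
    linked-last xs ls a (ℕ.suc-injective eq)

  -- Repeating `x` at the end makes the closing edge the last link of the chain, so one `Linked`
  -- yields both `step` and `close`.
  cycle : ∀ {k x} (xs : Vec V k) → 2 ℕ.≤ k → Unique (x ∷ xs) →
    Linked _~_ ((x ∷ xs) ∷ʳ x) → Cycle _~_ (suc k)
  cycle {x = x} xs 2≤k unique linked = record
    { 3≤k      = s≤s 2≤k
    ; vertex   = lookup (x ∷ xs)
    ; distinct = λ {a} {b} → lookup-injective unique a b
    ; step     = linked-step (x ∷ xs) linked
    ; close    = λ { a zero a-last _ → linked-last (x ∷ xs) linked a a-last }
    }

-- Congruences, residues and signs.

∣-multiple<⇒≡0 : ∀ {n x} → + n ∣ x → ∣ x ∣ ℕ.< n → x ≡ 0ℤ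
∣-multiple<⇒≡0 {n} {x} n∣x x<n with ∣ x ∣ in eq
... | zero  = ℤ.∣i∣≡0⇒i≡0 eq
... | suc k = contradiction (subst (n ℕ∣.∣_) eq (∣⇒∣ᵤ n∣x)) (>⇒∤ x<n)

≡mod-unique : ∀ {n a b} → a ℕ.< n → b ℕ.< n → + a ≡ + b [mod n ] → a ≡ b
≡mod-unique {n} {a} {b} a<n b<n a≡b =
  ℤ.+-injective (ℤ.i-j≡0⇒i≡j (+ a) (+ b) (∣-multiple<⇒≡0 a≡b small))
  where
  small : ∣ + a - + b ∣ ℕ.< n
  small = subst (λ x → ∣ x ∣ ℕ.< n) (sym (ℤ.m-n≡m⊖n a b))
    (ℕ.≤-<-trans (ℤ.∣m⊝n∣≤m⊔n a b) (ℕ.⊔-pres-<m a<n b<n))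

⟦⟧-injective : ∀ {n} {i j : Fin n} → ⟦ i ⟧ ≡ ⟦ j ⟧ [mod n ] → i ≡ j
⟦⟧-injective {i = i} {j} i≡j = toℕ-injective (≡mod-unique (toℕ<n i) (toℕ<n j) i≡j)

-- With `d` equal to 1, -1 or `ℓ`, this and `source-unique` are why a step is determined by either
-- of its endpoints.
target-unique : ∀ {n} (j k k′ : Fin n) d →
  ⟦ k ⟧ ≡ ⟦ j ⟧ + d [mod n ] → ⟦ k′ ⟧ ≡ ⟦ j ⟧ + d [mod n ] → k ≡ k′
target-unique {n} j k k′ d p q =
  ⟦⟧-injective (subst (+ n ∣_) (ring ⟦ j ⟧ ⟦ k ⟧ ⟦ k′ ⟧ d) (∣m∣n⇒∣m-n p q))
  where
  ring : ∀ j k k′ d → (k - (j + d)) - (k′ - (j + d)) ≡ k - k′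
  ring = solve-∀

source-unique : ∀ {n} (j j′ k : Fin n) d →
  ⟦ k ⟧ ≡ ⟦ j ⟧ + d [mod n ] → ⟦ k ⟧ ≡ ⟦ j′ ⟧ + d [mod n ] → j ≡ j′
source-unique {n} j j′ k d p q =
  ⟦⟧-injective (subst (+ n ∣_) (ring ⟦ j ⟧ ⟦ j′ ⟧ ⟦ k ⟧ d) (∣m∣n⇒∣m-n q p))
  where
  ring : ∀ j j′ k d → (k - (j′ + d)) - (k - (j + d)) ≡ j - j′
  ring = solve-∀

even-or-odd : ∀ x → + 2 ∣ x ⊎ (x ≡ 1ℤ [mod 2 ])
even-or-odd x with x %ℕ 2 | n%ℕd<d x 2 | a≡a%ℕn+[a/ℕn]*n x 2
... | 0 | _ | eq = inj₁ (divides (x /ℕ 2) (trans eq (ℤ.+-identityˡ _)))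
... | 1 | _ | eq = inj₂ (divides (x /ℕ 2) (trans (cong (_- 1ℤ) eq) (ring (x /ℕ 2))))
  where
  ring : ∀ q → 1ℤ + q * + 2 - 1ℤ ≡ q * + 2
  ring = solve-∀
... | suc (suc _) | s≤s (s≤s ()) | _

module _ {n : ℕ} .{{_ : NonZero n}} where

  ⟦mod⟧ : ∀ a → ⟦ a mod n ⟧ ≡ + a [mod n ]
  ⟦mod⟧ a = divides (- + (a / n)) (begin
    ⟦ a mod n ⟧ - + a
      ≡⟨ cong₂ (λ x y → + x - y) (toℕ-fromℕ< (m%n<n a n)) split ⟩
    + (a % n) - (+ (a % n) + + (a / n) * + n)
      ≡⟨ ring (+ (a % n)) (+ (a / n)) (+ n) ⟩
    - + (a / n) * + n
      ∎)
    where
    open ≡-Reasoning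
    split : + a ≡ + (a % n) + + (a / n) * + n
    split = begin
      + a                              ≡⟨ cong +_ (m≡m%n+[m/n]*n a n) ⟩
      + (a % n ℕ.+ a / n ℕ.* n)        ≡⟨ ℤ.pos-+ (a % n) (a / n ℕ.* n) ⟩
      + (a % n) + + (a / n ℕ.* n)      ≡⟨ cong (λ x → + (a % n) + x) (ℤ.pos-* (a / n) n) ⟩
      + (a % n) + + (a / n) * + n      ∎
    ring : ∀ r q k → r - (r + q * k) ≡ - q * k
    ring = solve-∀

  mod-≢ : ∀ {a b} → a ℕ.< n → b ℕ.< n → a ≢ b → a mod n ≢ b mod n
  mod-≢ {a} {b} a<n b<n a≢b eq = a≢b (≡mod-unique a<n b<n
    (subst (+ n ∣_) (ring (+ a) (+ b) ⟦ b mod n ⟧)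
      (∣m∣n⇒∣m-n (⟦mod⟧ b) (subst (λ x → ⟦ x ⟧ ≡ + a [mod n ]) eq (⟦mod⟧ a)))))
    where
    ring : ∀ x y r → (r - y) - (r - x) ≡ x - y
    ring = solve-∀

≢⇒≡opposite : ∀ {s t} → s ≢ t → s ≡ opposite t
≢⇒≡opposite {Sign.+} {Sign.+} s≢t = contradiction refl s≢t
≢⇒≡opposite {Sign.+} {Sign.-} _   = refl
≢⇒≡opposite {Sign.-} {Sign.+} _   = refl
≢⇒≡opposite {Sign.-} {Sign.-} s≢t = contradiction refl s≢t

-- Pigeonhole: among three signs, two agree.
opposite-triple : ∀ s t u → s ≡ opposite t → s ≡ opposite u → t ≢ opposite u
opposite-triple Sign.+ Sign.- Sign.- _ _ ()
opposite-triple Sign.- Sign.+ Sign.+ _ _ ()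

-- Steps in the graph and the patterns of a 4-cycle.

module Graph (m n : ℕ) (ℓ : ℤ) where

  V : Set
  V = Vertex m n

  infix 4 _~_
  _~_ : Rel V 0ℓ
  _~_ = HTG m n ℓ

  height : V → ℤ
  height (i , j) = ⟦ i ⟧ + ⟦ j ⟧

  Black : V → Set
  Black v = height v ≡ 1ℤ [mod 2 ]

  data Vertical (s : Sign) : V → V → Set where
    shift : ∀ {i j j′} → ⟦ j′ ⟧ ≡ ⟦ j ⟧ + (s ◃ 1) [mod n ] → Vertical s (i , j) (i , j′)

  -- Flat and jump edges as they are traversed from their black end. For `m = 1`, `wrap` stays
  -- within the single column.
  data Horizontal : V → V → Set where
    inner : ∀ {i i′ j} → toℕ i′ ≡ suc (toℕ i) → Horizontal (i , j) (i′ , j)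
    wrap  : ∀ {i i′ j j′} → suc (toℕ i) ≡ m → toℕ i′ ≡ 0 →
            ⟦ j′ ⟧ ≡ ⟦ j ⟧ + ℓ [mod n ] → Horizontal (i , j) (i′ , j′)

  Step : V → V → Set
  Step v w = (∃[ s ] Vertical s v w) ⊎ Horizontal v w

  vertical-functional : ∀ s {v w w′} → Vertical s v w → Vertical s v w′ → w ≡ w′
  vertical-functional s {_ , j} {_ , k} {_ , k′} (shift p) (shift q) =
    cong (_ ,_) (target-unique j k k′ (s ◃ 1) p q)

  vertical-injective : ∀ s {v v′ w} → Vertical s v w → Vertical s v′ w → v ≡ v′
  vertical-injective s {_ , j} {_ , j′} {_ , k} (shift p) (shift q) =
    cong (_ ,_) (source-unique j j′ k (s ◃ 1) p q)

  last-column : ∀ {i i′ : Fin m} → suc (toℕ i) ≡ m → toℕ i′ ≢ suc (toℕ i)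
  last-column {i′ = i′} i-last i′≡1+i = ℕ.<-irrefl (trans i′≡1+i i-last) (toℕ<n i′)

  -- `inner` and `wrap` cannot leave the same vertex, since the last column has no successor.
  horizontal-functional : ∀ {v w w′} → Horizontal v w → Horizontal v w′ → w ≡ w′
  horizontal-functional (inner p) (inner q) = cong (_, _) (toℕ-injective (trans p (sym q)))
  horizontal-functional (inner p) (wrap q _ _) = contradiction p (last-column q)
  horizontal-functional (wrap q _ _) (inner p) = contradiction p (last-column q)
  horizontal-functional {_ , j} {_ , k} {_ , k′} (wrap _ p r) (wrap _ q s) =
    cong₂ _,_ (toℕ-injective (trans p (sym q))) (target-unique j k k′ ℓ r s)

  -- `inner` and `wrap` cannot enter the same vertex, since column 0 has no predecessor.
  horizontal-injective : ∀ {v v′ w} → Horizontal v w → Horizontal v′ w → v ≡ v′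
  horizontal-injective (inner p) (inner q) =
    cong (_, _) (toℕ-injective (ℕ.suc-injective (trans (sym p) q)))
  horizontal-injective (inner p) (wrap _ q _) = contradiction (trans (sym p) q) λ ()
  horizontal-injective (wrap _ q _) (inner p) = contradiction (trans (sym p) q) λ ()
  horizontal-injective {_ , j} {_ , j′} {_ , k} (wrap p _ r) (wrap q _ s) =
    cong₂ _,_ (toℕ-injective (ℕ.suc-injective (trans p (sym q)))) (source-unique j j′ k ℓ r s)

  -- What a 4-cycle forces, according to the columns and jump edges that it uses.
  data Coincidence : Set where
    column    : + n ∣ + 4 → Coincidence
    one-jump  : m ≡ 1 → (ℓ ≡ + 3 [mod n ]) ⊎ (ℓ ≡ - + 3 [mod n ]) → Coincidence
    two-jumps : m ≡ 1 → ∀ s t → ℓ + ℓ ≡ (s ◃ 1) + (t ◃ 1) [mod n ] → Coincidence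
    two-cols  : m ≡ 2 → ∀ s t → ℓ ≡ (s ◃ 1) + (t ◃ 1) [mod n ] → Coincidence

  vertical-sources : ∀ {s t v v′ w} → v ≢ v′ → Vertical s v w → Vertical t v′ w → s ≡ opposite t
  vertical-sources v≢v′ p q = ≢⇒≡opposite λ { refl → v≢v′ (vertical-injective _ p q) }

  vertical-targets : ∀ {s t v w w′} → w ≢ w′ → Vertical s v w → Vertical t v w′ → s ≡ opposite t
  vertical-targets w≢w′ p q = ≢⇒≡opposite λ { refl → w≢w′ (vertical-functional _ p q) }

  -- Here and below `v₀` and `v₂` play the black vertices. Going round the cycle gives
  -- `(s - u) - (t - r) ≡ 0`. Steps sharing an endpoint have opposite signs, so `s` and `r` agree
  -- and are opposite to `t` and `u`; the sum is 4 or -4.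
  no-horizontal : ∀ {s t u r v₀ v₁ v₂ v₃} → v₀ ≢ v₂ → v₁ ≢ v₃ →
    Vertical s v₀ v₁ → Vertical t v₀ v₃ → Vertical u v₂ v₁ → Vertical r v₂ v₃ → Coincidence
  no-horizontal {s} {t} {u} {r} {_ , j₀} {_ , j₁} {_ , j₂} {_ , j₃} v₀≢v₂ v₁≢v₃
    p₀₁@(shift a) p₀₃@(shift b) p₂₁@(shift c) p₂₃@(shift d) =
    column (signs s t u r (vertical-targets v₁≢v₃ p₀₁ p₀₃)
      (vertical-sources v₀≢v₂ p₀₁ p₂₁) (vertical-sources v₀≢v₂ p₀₃ p₂₃)
      (subst (+ n ∣_) (ring ⟦ j₀ ⟧ ⟦ j₁ ⟧ ⟦ j₂ ⟧ ⟦ j₃ ⟧ (s ◃ 1) (t ◃ 1) (u ◃ 1) (r ◃ 1))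
        (∣m∣n⇒∣m-n (∣m∣n⇒∣m-n c a) (∣m∣n⇒∣m-n d b))))
    where
    ring : ∀ j₀ j₁ j₂ j₃ s t u r →
      ((j₁ - (j₂ + u)) - (j₁ - (j₀ + s))) - ((j₃ - (j₂ + r)) - (j₃ - (j₀ + t))) ≡
      (s - u) - (t - r)
    ring = solve-∀
    signs : ∀ s t u r → s ≡ opposite t → s ≡ opposite u → t ≡ opposite r →
      + n ∣ ((s ◃ 1) - (u ◃ 1)) - ((t ◃ 1) - (r ◃ 1)) → + n ∣ + 4
    signs Sign.+ Sign.- Sign.- Sign.+ _ _ _ n∣4  = n∣4
    signs Sign.- Sign.+ Sign.+ Sign.- _ _ _ n∣-4 = ∣m⇒∣-m n∣-4

  -- The three vertical steps keep everything in one column, so the horizontal step returns to its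
  -- own column: it is a jump and `m = 1`. Then `ℓ ≡ u + t - r`, where `t` and `u` are both opposite
  -- to `r`.
  one-horizontal : ∀ {t u r v₀ v₁ v₂ v₃} → v₀ ≢ v₂ → v₁ ≢ v₃ →
    Horizontal v₀ v₁ → Vertical t v₀ v₃ → Vertical u v₂ v₁ → Vertical r v₂ v₃ → Coincidence
  one-horizontal _ _ (inner p) (shift _) (shift _) (shift _) = contradiction (sym p) ℕ.1+n≢n
  one-horizontal {t} {u} {r} {_ , j₀} {_ , j₁} {_ , j₂} {_ , j₃} v₀≢v₂ v₁≢v₃ (wrap p q a)
    p₀₃@(shift b) p₂₁@(shift c) p₂₃@(shift d) =
    one-jump (trans (sym p) (cong suc q))
      (signs t u r (vertical-targets v₁≢v₃ p₂₁ p₂₃) (vertical-sources v₀≢v₂ p₀₃ p₂₃)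
        (subst (+ n ∣_) (ring ⟦ j₀ ⟧ ⟦ j₁ ⟧ ⟦ j₂ ⟧ ⟦ j₃ ⟧ ℓ (t ◃ 1) (u ◃ 1) (r ◃ 1))
          (∣m∣n⇒∣m-n (∣m∣n⇒∣m+n (∣m∣n⇒∣m-n c a) b) d)))
    where
    ring : ∀ j₀ j₁ j₂ j₃ l t u r →
      (((j₁ - (j₂ + u)) - (j₁ - (j₀ + l))) + (j₃ - (j₀ + t))) - (j₃ - (j₂ + r)) ≡
      l - (u + (t - r))
    ring = solve-∀
    signs : ∀ t u r → u ≡ opposite r → t ≡ opposite r →
      ℓ ≡ (u ◃ 1) + ((t ◃ 1) - (r ◃ 1)) [mod n ] →
      (ℓ ≡ + 3 [mod n ]) ⊎ (ℓ ≡ - + 3 [mod n ])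
    signs Sign.+ Sign.+ Sign.- _ _ ℓ≡3  = inj₁ ℓ≡3
    signs Sign.- Sign.- Sign.+ _ _ ℓ≡-3 = inj₂ ℓ≡-3

  -- The vertical steps make the second horizontal step lead back to the column where the first
  -- began, so going twice to the cyclically next column is a return. Hence `m` is 1 or 2, according
  -- to whether both steps or just one of them is a jump.
  two-horizontal : ∀ {t u v₀ v₁ v₂ v₃} →
    Horizontal v₀ v₁ → Vertical t v₀ v₃ → Vertical u v₂ v₁ → Horizontal v₂ v₃ → Coincidence
  two-horizontal (inner p) (shift _) (shift _) (inner q) =
    contradiction (ℕ.n≤1+n _) (ℕ.<-irrefl (trans q (cong suc p)))
  two-horizontal {t} {u} {_ , j₀} {_ , j₁} {_ , j₂} {_ , j₃} (inner p) (shift b) (shift c)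
    (wrap q q′ d) =
    two-cols (trans (sym q) (cong suc (trans p (cong suc q′)))) t u
      (subst (+ n ∣_) (ring ⟦ j₀ ⟧ ⟦ j₂ ⟧ ⟦ j₃ ⟧ ℓ (t ◃ 1) (u ◃ 1)) (∣m∣n⇒∣m+n (∣m∣n⇒∣m-n b d) c))
    where
    ring : ∀ j₀ j₂ j₃ l t u → ((j₃ - (j₀ + t)) - (j₃ - (j₂ + l))) + (j₀ - (j₂ + u)) ≡ l - (t + u)
    ring = solve-∀
  two-horizontal {t} {u} {_ , j₀} {_ , j₁} {_ , j₂} (wrap p p′ a) (shift b) (shift c) (inner q) =
    two-cols (trans (sym p) (cong suc (trans q (cong suc p′)))) t u
      (subst (+ n ∣_) (ring ⟦ j₀ ⟧ ⟦ j₁ ⟧ ⟦ j₂ ⟧ ℓ (t ◃ 1) (u ◃ 1)) (∣m∣n⇒∣m+n (∣m∣n⇒∣m-n c a) b))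
    where
    ring : ∀ j₀ j₁ j₂ l t u → ((j₁ - (j₂ + u)) - (j₁ - (j₀ + l))) + (j₂ - (j₀ + t)) ≡ l - (t + u)
    ring = solve-∀
  two-horizontal {t} {u} {_ , j₀} {_ , j₁} {_ , j₂} {_ , j₃} (wrap p p′ a) (shift b) (shift c)
    (wrap q q′ d) =
    two-jumps (trans (sym p) (cong suc q′)) t u
      (subst (+ n ∣_) (ring ⟦ j₀ ⟧ ⟦ j₁ ⟧ ⟦ j₂ ⟧ ⟦ j₃ ⟧ ℓ (t ◃ 1) (u ◃ 1))
        (∣m∣n⇒∣m+n (∣m∣n⇒∣m-n c a) (∣m∣n⇒∣m-n b d)))
    where
    ring : ∀ j₀ j₁ j₂ j₃ l t u → ((j₁ - (j₂ + u)) - (j₁ - (j₀ + l))) + ((j₃ - (j₀ + t)) - (j₃ - (j₂ + l))) ≡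
      (l + l) - (t + u)
    ring = solve-∀

  steps⇒coincidence : ∀ {v₀ v₁ v₂ v₃} → v₀ ≢ v₂ → v₁ ≢ v₃ →
    Step v₀ v₁ → Step v₀ v₃ → Step v₂ v₁ → Step v₂ v₃ → Coincidence
  steps⇒coincidence v₀≢v₂ v₁≢v₃ = λ where
    -- Two horizontal steps sharing an endpoint would coincide, so horizontal steps occupy at most
    -- two opposite sides.
    (inj₂ a) (inj₂ b) _ _ → contradiction (horizontal-functional a b) v₁≢v₃
    (inj₂ a) _ (inj₂ c) _ → contradiction (horizontal-injective a c) v₀≢v₂
    _ (inj₂ b) _ (inj₂ d) → contradiction (horizontal-injective b d) v₀≢v₂
    _ _ (inj₂ c) (inj₂ d) → contradiction (horizontal-functional c d) v₁≢v₃
    -- The surviving patterns reach standard position by exchanging `v₀` with `v₂`, or `v₁` with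
    -- `v₃`, or both.
    (inj₂ a) (inj₁ (_ , b)) (inj₁ (_ , c)) (inj₂ d) → two-horizontal a b c d
    (inj₁ (_ , a)) (inj₂ b) (inj₂ c) (inj₁ (_ , d)) → two-horizontal b a d c
    (inj₂ a) (inj₁ (_ , b)) (inj₁ (_ , c)) (inj₁ (_ , d)) → one-horizontal v₀≢v₂ v₁≢v₃ a b c d
    (inj₁ (_ , a)) (inj₂ b) (inj₁ (_ , c)) (inj₁ (_ , d)) → one-horizontal v₀≢v₂ (≢-sym v₁≢v₃) b a d c
    (inj₁ (_ , a)) (inj₁ (_ , b)) (inj₂ c) (inj₁ (_ , d)) → one-horizontal (≢-sym v₀≢v₂) v₁≢v₃ c d a b
    (inj₁ (_ , a)) (inj₁ (_ , b)) (inj₁ (_ , c)) (inj₂ d) → one-horizontal (≢-sym v₀≢v₂) (≢-sym v₁≢v₃) d c b a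
    (inj₁ (_ , a)) (inj₁ (_ , b)) (inj₁ (_ , c)) (inj₁ (_ , d)) → no-horizontal v₀≢v₂ v₁≢v₃ a b c d

  -- The two-colouring and its consequences.

  module Bipartite (2∣n : + 2 ∣ + n) (ℓ≡m : ℓ ≡ + m [mod 2 ]) where

    -- Reduction modulo the even number `n` preserves parity. A jump changes the height by
    -- `ℓ - (m - 1)`, which is odd because `ℓ ≡ m`.
    edge-parity : ∀ {v w} → Edge m n ℓ v w → height w ≡ height v + 1ℤ [mod 2 ]
    edge-parity (vertical {i} {j} {j′} j′≡j+1) =
      subst (+ 2 ∣_) (ring ⟦ i ⟧ ⟦ j ⟧ ⟦ j′ ⟧) (∣-trans 2∣n j′≡j+1)
      where
      ring : ∀ i j j′ → j′ - (j + 1ℤ) ≡ (i + j′) - (i + j + 1ℤ)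
      ring = solve-∀
    edge-parity (flat {i} {i′} {j} i′≡1+i _) =
      divides 0ℤ (trans (cong (λ x → + x + ⟦ j ⟧ - (⟦ i ⟧ + ⟦ j ⟧ + 1ℤ)) i′≡1+i)
        (ring ⟦ i ⟧ ⟦ j ⟧))
      where
      ring : ∀ i j → (1ℤ + i) + j - (i + j + 1ℤ) ≡ 0ℤ
      ring = solve-∀
    edge-parity (jump {i} {i′} {j} {j′} 1+i≡m i′≡0 _ j′≡j+ℓ) =
      subst (λ x → + x + ⟦ j′ ⟧ ≡ ⟦ i ⟧ + ⟦ j ⟧ + 1ℤ [mod 2 ]) (sym i′≡0)
        (subst (+ 2 ∣_) (ring ⟦ i ⟧ ⟦ j ⟧ ⟦ j′ ⟧ ℓ)
          (∣m∣n⇒∣m+n (∣-trans 2∣n j′≡j+ℓ) (subst (λ k → ℓ ≡ + k [mod 2 ]) (sym 1+i≡m) ℓ≡m)))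
      where
      ring : ∀ i j j′ l → (j′ - (j + l)) + (l - (1ℤ + i)) ≡ (0ℤ + j′) - (i + j + 1ℤ)
      ring = solve-∀

    path₁-parity : ∀ {v w} → v ~ w → height w ≡ height v + 1ℤ [mod 2 ]
    path₁-parity (fwd e) = edge-parity e
    path₁-parity {v} {w} (bwd e) =
      subst (+ 2 ∣_) (ring (height v) (height w))
        (∣m∣n⇒∣m-n (∣m⇒∣-m (edge-parity e)) (divides 1ℤ refl))
      where
      ring : ∀ p q → - (p - (q + 1ℤ)) - + 2 ≡ q - (p + 1ℤ)
      ring = solve-∀

    path₃-parity : ∀ {a b c d} → a ~ b → b ~ c → c ~ d → height d ≡ height a + + 3 [mod 2 ]
    path₃-parity {a} {b} {c} {d} p q r =
      subst (+ 2 ∣_) (ring (height a) (height b) (height c) (height d))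
        (∣m∣n⇒∣m+n (∣m∣n⇒∣m+n (path₁-parity p) (path₁-parity q)) (path₁-parity r))
      where
      ring : ∀ a b c d → ((b - (a + 1ℤ)) + (c - (b + 1ℤ))) + (d - (c + 1ℤ)) ≡ d - (a + + 3)
      ring = solve-∀

    path₁-≢ : ∀ {v w} → v ~ w → v ≢ w
    path₁-≢ {v} e refl =
      from-no (+ 2 ∣? - 1ℤ) (subst (+ 2 ∣_) (ring (height v)) (path₁-parity e))
      where
      ring : ∀ p → p - (p + 1ℤ) ≡ - 1ℤ
      ring = solve-∀

    path₃-≢ : ∀ {a b c d} → a ~ b → b ~ c → c ~ d → a ≢ d
    path₃-≢ {a} p q r refl =
      from-no (+ 2 ∣? - + 3) (subst (+ 2 ∣_) (ring (height a)) (path₃-parity p q r))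
      where
      ring : ∀ p → p - (p + + 3) ≡ - + 3
      ring = solve-∀

    path₅-≢ : ∀ {a b c d e f} → a ~ b → b ~ c → c ~ d → d ~ e → e ~ f → a ≢ f
    path₅-≢ {a} {d = d} {e} p q r s t refl =
      from-no (+ 2 ∣? - + 5) (subst (+ 2 ∣_) (ring (height a) (height d) (height e))
        (∣m∣n⇒∣m+n (∣m∣n⇒∣m+n (path₃-parity p q r) (path₁-parity s)) (path₁-parity t)))
      where
      ring : ∀ a d e → ((d - (a + + 3)) + (e - (d + 1ℤ))) + (a - (e + 1ℤ)) ≡ - + 5
      ring = solve-∀

    -- Vertices of different colours differ automatically, so here and in `hexagon` only pairs of
    -- the same colour need an inequality.
    quadrilateral : ∀ {a b c d} → a ~ b → b ~ c → c ~ d → d ~ a →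
      a ≢ c → b ≢ d → Cycle _~_ 4
    quadrilateral {a} {b} {c} {d} ab bc cd da a≢c b≢d =
      cycle (b ∷ c ∷ d ∷ []) (s≤s (s≤s z≤n))
        ( (path₁-≢ ab ∷ a≢c ∷ ≢-sym (path₁-≢ da) ∷ [])
        ∷ (path₁-≢ bc ∷ b≢d ∷ [])
        ∷ (path₁-≢ cd ∷ []) ∷ [] ∷ [])
        (ab ∷ bc ∷ cd ∷ da ∷ [-])

    hexagon : ∀ {a b c d e f} → a ~ b → b ~ c → c ~ d → d ~ e → e ~ f → f ~ a →
      a ≢ c → a ≢ e → c ≢ e → b ≢ d → b ≢ f → d ≢ f → Cycle _~_ 6
    hexagon {a} {b} {c} {d} {e} {f} ab bc cd de ef fa a≢c a≢e c≢e b≢d b≢f d≢f =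
      cycle (b ∷ c ∷ d ∷ e ∷ f ∷ []) (s≤s (s≤s z≤n))
        ( (path₁-≢ ab ∷ a≢c ∷ path₃-≢ ab bc cd ∷ a≢e ∷ ≢-sym (path₁-≢ fa) ∷ [])
        ∷ (path₁-≢ bc ∷ b≢d ∷ path₃-≢ bc cd de ∷ b≢f ∷ [])
        ∷ (path₁-≢ cd ∷ c≢e ∷ path₃-≢ cd de ef ∷ [])
        ∷ (path₁-≢ de ∷ d≢f ∷ [])
        ∷ (path₁-≢ ef ∷ []) ∷ [] ∷ [])
        (ab ∷ bc ∷ cd ∷ de ∷ ef ∷ fa ∷ [-])

    ¬both-black : ∀ {v w} → v ~ w → Black v → Black w → ⊥
    ¬both-black {v} {w} e v-black w-black =
      from-no (+ 2 ∣? 1ℤ) (subst (+ 2 ∣_) (ring (height v) (height w))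
        (∣m∣n⇒∣m-n (∣m∣n⇒∣m-n w-black v-black) (path₁-parity e)))
      where
      ring : ∀ p q → ((q - 1ℤ) - (p - 1ℤ)) - (q - (p + 1ℤ)) ≡ 1ℤ
      ring = solve-∀

    jump-source-black : ∀ {i j} → suc (toℕ i) ≡ m → ⟦ j ⟧ ≡ + m [mod 2 ] → Black (i , j)
    jump-source-black {i} {j} 1+i≡m j≡m =
      subst (+ 2 ∣_) (ring ⟦ i ⟧ ⟦ j ⟧)
        (∣m∣n⇒∣m+n (subst (λ k → ⟦ j ⟧ ≡ + k [mod 2 ]) (sym 1+i≡m) j≡m) (divides ⟦ i ⟧ refl))
      where
      ring : ∀ i j → (j - (1ℤ + i)) + i * + 2 ≡ (i + j) - 1ℤ
      ring = solve-∀

    -- Flat and jump edges are directed out of a black vertex, so traversing one backwards from a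
    -- black vertex would make both its ends black.
    black-step : ∀ {v w} → v ~ w → Black v → Step v w
    black-step (fwd (vertical p))   _ = inj₁ (Sign.+ , shift p)
    black-step (fwd (flat p _))     _ = inj₂ (inner p)
    black-step (fwd (jump p q _ r)) _ = inj₂ (wrap p q r)
    black-step (bwd (vertical {j = j} {j′} p)) _ =
      inj₁ (Sign.- , shift (subst (+ n ∣_) (ring ⟦ j ⟧ ⟦ j′ ⟧) (∣m⇒∣-m p)))
      where
      ring : ∀ j j′ → - (j′ - (j + 1ℤ)) ≡ j - (j′ - 1ℤ)
      ring = solve-∀
    black-step e@(bwd (flat _ w-black)) v-black = ⊥-elim (¬both-black e v-black w-black)
    black-step e@(bwd (jump p _ q _))   v-black =
      ⊥-elim (¬both-black e v-black (jump-source-black p q))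

    black-or-neighbour-black : ∀ {v w} → v ~ w → Black v ⊎ Black w
    black-or-neighbour-black {v} {w} e with even-or-odd (height v)
    ... | inj₂ v-odd  = inj₁ v-odd
    ... | inj₁ v-even =
      inj₂ (subst (+ 2 ∣_) (ring (height v) (height w)) (∣m∣n⇒∣m+n (path₁-parity e) v-even))
      where
      ring : ∀ p q → (q - (p + 1ℤ)) + p ≡ q - 1ℤ
      ring = solve-∀

    black-path₂ : ∀ {a b c} → a ~ b → b ~ c → Black a → Black c
    black-path₂ {a} {b} {c} ab bc a-black =
      subst (+ 2 ∣_) (ring (height a) (height b) (height c))
        (∣m∣n⇒∣m+n (∣m∣n⇒∣m+n (∣m∣n⇒∣m+n (path₁-parity ab) (path₁-parity bc)) a-black)
          (divides 1ℤ refl))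
      where
      ring : ∀ a b c → (((b - (a + 1ℤ)) + (c - (b + 1ℤ))) + (a - 1ℤ)) + + 2 ≡ c - 1ℤ
      ring = solve-∀

    black-quadrilateral⇒coincidence : ∀ {a b c d} → a ~ b → b ~ c → c ~ d → d ~ a →
      a ≢ c → b ≢ d → Black a → Coincidence
    black-quadrilateral⇒coincidence ab bc cd da a≢c b≢d a-black =
      steps⇒coincidence a≢c b≢d
        (black-step ab a-black) (black-step (flip da) a-black)
        (black-step (flip bc) c-black) (black-step cd c-black)
      where
      flip    = symmetric (Edge m n ℓ)
      c-black = black-path₂ ab bc a-black

    4-cycle⇒coincidence : Cycle _~_ 4 → Coincidence
    4-cycle⇒coincidence C with black-or-neighbour-black (C.step 0F 1F refl)
      where module C = Cycle C
    ... | inj₁ 0-black = black-quadrilateral⇒coincidence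
      (C.step 0F 1F refl) (C.step 1F 2F refl) (C.step 2F 3F refl) (C.close 3F 0F refl refl)
      (λ eq → contradiction (C.distinct eq) λ ()) (λ eq → contradiction (C.distinct eq) λ ()) 0-black
      where module C = Cycle C
    -- The same cycle, rotated by one place so that it starts at a black vertex.
    ... | inj₂ 1-black = black-quadrilateral⇒coincidence
      (C.step 1F 2F refl) (C.step 2F 3F refl) (C.close 3F 0F refl refl) (C.step 0F 1F refl)
      (λ eq → contradiction (C.distinct eq) λ ()) (λ eq → contradiction (C.distinct eq) λ ()) 1-black
      where module C = Cycle C

    girth≥4 : ∀ {k} → Cycle _~_ k → 4 ℕ.≤ k
    girth≥4 {k} C with k ℕ.≟ 3
    ... | no k≢3   = ℕ.≤∧≢⇒< C.3≤k (≢-sym k≢3)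
      where module C = Cycle C
    ... | yes refl = contradiction refl
      (path₃-≢ (C.step 0F 1F refl) (C.step 1F 2F refl) (C.close 2F 0F refl refl))
      where module C = Cycle C

    girth≥6 : ¬ Cycle _~_ 4 → ∀ {k} → Cycle _~_ k → 6 ℕ.≤ k
    girth≥6 ¬4-cycle {k} C with k ℕ.≟ 4 | k ℕ.≟ 5
    ... | yes refl | _        = contradiction C ¬4-cycle
    ... | no k≢4   | no k≢5   = ℕ.≤∧≢⇒< (ℕ.≤∧≢⇒< (girth≥4 C) (≢-sym k≢4)) (≢-sym k≢5)
    ... | no _     | yes refl = contradiction refl
      (path₅-≢ (C.step 0F 1F refl) (C.step 1F 2F refl) (C.step 2F 3F refl) (C.step 3F 4F refl)
        (C.close 4F 0F refl refl))
      where module C = Cycle C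

  -- Vertices and edges with natural-number subscripts.

  module _ .{{_ : NonZero n}} where

    at : Fin m → ℕ → V
    at i a = i , a mod n

    mod-≡-+ : ∀ a b x → + b ≡ + a + x [mod n ] → ⟦ b mod n ⟧ ≡ ⟦ a mod n ⟧ + x [mod n ]
    mod-≡-+ a b x b≡a+x =
      subst (+ n ∣_) (ring (+ a) (+ b) x ⟦ a mod n ⟧ ⟦ b mod n ⟧)
        (∣m∣n⇒∣m-n (∣m∣n⇒∣m+n (⟦mod⟧ b) b≡a+x) (⟦mod⟧ a))
      where
      ring : ∀ a b x r s → ((s - b) + (b - (a + x))) - (r - a) ≡ s - (r + x)
      ring = solve-∀

    up : ∀ {i} a → at i a ~ at i (suc a)
    up a = fwd (vertical (mod-≡-+ a (suc a) 1ℤ (divides 0ℤ (ring (+ a)))))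
      where
      ring : ∀ a → 1ℤ + a - (a + 1ℤ) ≡ 0ℤ
      ring = solve-∀

    down : ∀ {i} a → at i (suc a) ~ at i a
    down a = symmetric (Edge m n ℓ) (up a)

    mod-parity : + 2 ∣ + n → ∀ a → ⟦ a mod n ⟧ ≡ + a [mod 2 ]
    mod-parity 2∣n a = ∣-trans 2∣n (⟦mod⟧ a)

    across : + 2 ∣ + n → ∀ {i i′} a → toℕ i′ ≡ suc (toℕ i) → ⟦ i ⟧ + + a ≡ 1ℤ [mod 2 ] →
      at i a ~ at i′ a
    across 2∣n {i} a i′≡1+i odd = fwd (flat i′≡1+i
      (subst (+ 2 ∣_) (ring ⟦ i ⟧ (+ a) ⟦ a mod n ⟧) (∣m∣n⇒∣m+n odd (mod-parity 2∣n a))))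
      where
      ring : ∀ i a r → (i + a - 1ℤ) + (r - a) ≡ i + r - 1ℤ
      ring = solve-∀

    leap : + 2 ∣ + n → ∀ {i i′} a b → suc (toℕ i) ≡ m → toℕ i′ ≡ 0 → + a ≡ + m [mod 2 ] →
      + b ≡ + a + ℓ [mod n ] → at i a ~ at i′ b
    leap 2∣n a b i-last i′-first a≡m b≡a+ℓ = fwd (jump i-last i′-first
      (subst (+ 2 ∣_) (ring (+ a) (+ m) ⟦ a mod n ⟧) (∣m∣n⇒∣m+n a≡m (mod-parity 2∣n a)))
      (mod-≡-+ a b ℓ b≡a+ℓ))
      where
      ring : ∀ a m r → (a - m) + (r - a) ≡ r - m
      ring = solve-∀

-- Cubicity, and solving the congruences in normal form.

-- Three distinct vertical neighbours would need three pairwise opposite signs.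
vertical-degree≢3 : ∀ {m n ℓ v} → let open Graph m n ℓ in
  (∀ {w} → v ~ w → ∃[ s ] Vertical s v w) → ¬ HasDegree _~_ v 3
vertical-degree≢3 {m} {n} {ℓ} all-vertical
  (x ∷ y ∷ z ∷ [] , refl , (x≢y ∷ x≢z ∷ []) ∷ (y≢z ∷ []) ∷ _ , neighbours)
  with all-vertical (Equivalence.to (neighbours x) (here refl))
     | all-vertical (Equivalence.to (neighbours y) (there (here refl)))
     | all-vertical (Equivalence.to (neighbours z) (there (there (here refl))))
... | s , x-vertical | t , y-vertical | u , z-vertical =
  opposite-triple s t u (vertical-targets x≢y x-vertical y-vertical)
    (vertical-targets x≢z x-vertical z-vertical) (vertical-targets y≢z y-vertical z-vertical)
  where open Graph m n ℓ

-- Turns congruences such as `l + 3 ≡ 0` into equations: the normal form keeps the left side below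
-- `2n`.
∣-positive<2*⇒≡ : ∀ {n a} → n ℕ∣.∣ a → 0 ℕ.< a → a ℕ.< n ℕ.+ n → a ≡ n
∣-positive<2*⇒≡ {n} (ℕ∣.divides 0 refl) () _
∣-positive<2*⇒≡ {n} (ℕ∣.divides 1 refl) _ _ = ℕ.*-identityˡ n
∣-positive<2*⇒≡ {n} (ℕ∣.divides (suc (suc q)) refl) _ a<2n =
  contradiction (ℕ.+-monoʳ-≤ n (ℕ.m≤m+n n (q ℕ.* n))) (ℕ.<⇒≱ a<2n)

*2≡+ : ∀ k → k ℕ.* 2 ≡ k ℕ.+ k
*2≡+ k = trans (ℕ.*-comm k 2) (cong (k ℕ.+_) (ℕ.+-identityʳ k))

4<h*2⇒2<h : ∀ {h} → 4 ℕ.< h ℕ.* 2 → 2 ℕ.< h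
4<h*2⇒2<h {h} = ℕ.*-cancelʳ-< 2 2 h

odd : ∀ {l} → + l ≡ 1ℤ [mod 2 ] → ∃[ q ] l ≡ 1 ℕ.+ q ℕ.* 2
odd {zero}  l≡1 = contradiction l≡1 (from-no (+ 2 ∣? - 1ℤ))
odd {suc l} l≡1 with ∣⇒∣ᵤ l≡1
... | ℕ∣.divides q eq = q , cong suc eq

module _ {m h l : ℕ} (4≤n : 4 ℕ.≤ h ℕ.* 2) (ℓ≡m : + l ≡ + m [mod 2 ]) (l≤h : l ℕ.≤ h)
  (m≡1⇒l≢1 : m ≡ 1 → l ≢ 1) where

  private
    n : ℕ
    n = h ℕ.* 2

  open Graph m n (+ l) using (Coincidence; column; one-jump; two-jumps; two-cols)

  module _ (4<n : 4 ℕ.< n) where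

    2<h : 2 ℕ.< h
    2<h = 4<h*2⇒2<h 4<n

    h<n : h ℕ.< n
    h<n = ℕ.m<m*n h 2 {{ℕ.>-nonZero (ℕ.<-trans (s≤s z≤n) 2<h)}} (s≤s (s≤s z≤n))

    l<n : l ℕ.< n
    l<n = ℕ.≤-<-trans l≤h h<n

    l+l≤n : l ℕ.+ l ℕ.≤ n
    l+l≤n = subst (l ℕ.+ l ℕ.≤_) (sym (*2≡+ h)) (ℕ.+-mono-≤ l≤h l≤h)

    m≡1⇒l-odd : m ≡ 1 → ∃[ q ] l ≡ 1 ℕ.+ q ℕ.* 2
    m≡1⇒l-odd refl = odd ℓ≡m

    0<l : m ≡ 1 → 0 ℕ.< l
    0<l m≡1 with m≡1⇒l-odd m≡1
    ... | _ , refl = s≤s z≤n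

    -- Since `l` is at most half of `n`, its complement is at least half. A small `c` therefore
    -- bounds `n`.
    h≤c⇐l+c≡n : ∀ c → l ℕ.+ c ≡ n → h ℕ.≤ c
    h≤c⇐l+c≡n c l+c≡n = ℕ.+-cancelˡ-≤ h h c (begin
      h ℕ.+ h ≡⟨ *2≡+ h ⟨
      n       ≡⟨ l+c≡n ⟨
      l ℕ.+ c ≤⟨ ℕ.+-monoˡ-≤ c l≤h ⟩
      h ℕ.+ c ∎)
      where open ℕ.≤-Reasoning

    l+l≡n⇒Exceptional : m ≡ 1 → l ℕ.+ l ≡ n → Exceptional m n (+ l)
    l+l≡n⇒Exceptional m≡1 l+l≡n
      with ℕ.*-cancelʳ-≡ l h 2 (trans (*2≡+ l) l+l≡n) | m≡1⇒l-odd m≡1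
    -- Now `h = l = 1 + 2q`, whence `n = 2 + 4q`.
    ... | refl | q , refl = case₃ m≡1 4<n n%4≡2 (cong +_ (sym (m*n/n≡m l 2)))
      where
      n%4≡2 : n % 4 ≡ 2
      n%4≡2 = trans (cong (λ x → (2 ℕ.+ x) % 4) (ℕ.*-assoc q 2 2)) ([m+kn]%n≡m%n 2 q 4)

    l+l+2≡n⇒Exceptional : m ≡ 1 → l ℕ.+ l ℕ.+ 2 ≡ n → Exceptional m n (+ l)
    l+l+2≡n⇒Exceptional m≡1 l+l+2≡n
      with ℕ.*-cancelʳ-≡ (suc l) h 2
        (trans (cong (2 ℕ.+_) (*2≡+ l)) (trans (ℕ.+-comm 2 (l ℕ.+ l)) l+l+2≡n))
         | m≡1⇒l-odd m≡1
    -- Now `h = suc l`, so `n ∸ 2` reduces to `l * 2`, and `l = 1 + 2q` gives `n = 4 + 4q`.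
    ... | refl | q , refl = case₄ m≡1 4<n n%4≡0 (cong +_ (sym (m*n/n≡m l 2)))
      where
      n%4≡0 : n % 4 ≡ 0
      n%4≡0 = trans (cong (λ x → (4 ℕ.+ x) % 4) (ℕ.*-assoc q 2 2)) ([m+kn]%n≡m%n 0 (suc q) 4)

    -- For `l = 1 + 2q` the difference `2l - 2 = 4q` is a multiple of `n` smaller than `n`. So
    -- `q = 0` and `l = 1`, the excluded value.
    l+l≢2 : m ≡ 1 → ¬ (+ l + + l ≡ + 2 [mod n ])
    l+l≢2 m≡1 2l≡2 with m≡1⇒l-odd m≡1
    ... | q , refl = m≡1⇒l≢1 m≡1 (cong suc (ℕ.m+n≡0⇒m≡0 (q ℕ.* 2) (ℤ.+-injective
      (∣-multiple<⇒≡0 (subst (+ n ∣_) (ring (+ (q ℕ.* 2))) 2l≡2)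
        (subst (q ℕ.* 2 ℕ.+ q ℕ.* 2 ℕ.<_) (sym (*2≡+ h)) (ℕ.+-mono-< l≤h l≤h))))))
      where
      ring : ∀ x → (1ℤ + x) + (1ℤ + x) - + 2 ≡ x + x
      ring = solve-∀

    l+l≡0⇒Exceptional : m ≡ 1 → + l + + l ≡ 0ℤ [mod n ] → Exceptional m n (+ l)
    l+l≡0⇒Exceptional m≡1 2l≡0 = l+l≡n⇒Exceptional m≡1
      (∣-positive<2*⇒≡ (subst (n ℕ∣.∣_) (ℕ.+-identityʳ (l ℕ.+ l)) (∣⇒∣ᵤ 2l≡0))
        (ℕ.<-≤-trans (0<l m≡1) (ℕ.m≤m+n l l)) (ℕ.+-mono-< l<n l<n))

    large-coincidence⇒Exceptional : Coincidence → Exceptional m n (+ l)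
    large-coincidence⇒Exceptional (column n∣4) =
      contradiction (∣⇒∣ᵤ n∣4) (>⇒∤ 4<n)
    large-coincidence⇒Exceptional (one-jump m≡1 (inj₁ ℓ≡3)) =
      case₂ m≡1 4<n (cong +_ (≡mod-unique l<n (ℕ.<-trans ℕ.≤-refl 4<n) ℓ≡3))
    large-coincidence⇒Exceptional (one-jump m≡1 (inj₂ ℓ≡-3))
      with ∣-positive<2*⇒≡ (∣⇒∣ᵤ ℓ≡-3) (ℕ.m≤n⇒m≤o+n l (s≤s z≤n))
        (ℕ.+-mono-< l<n (ℕ.<-trans ℕ.≤-refl 4<n))
    -- The bound leaves only `h = 3`, so `n = 6` and `l = 3`: this is again the case `ℓ = 3`.
    ... | l+3≡n with ℕ.≤-antisym (h≤c⇐l+c≡n 3 l+3≡n) 2<h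
    ... | refl = case₂ m≡1 4<n (cong +_ (ℕ.+-cancelʳ-≡ 3 l 3 l+3≡n))
    large-coincidence⇒Exceptional (two-jumps m≡1 Sign.+ Sign.+ 2ℓ≡2) =
      contradiction 2ℓ≡2 (l+l≢2 m≡1)
    large-coincidence⇒Exceptional (two-jumps m≡1 Sign.+ Sign.- 2ℓ≡0) = l+l≡0⇒Exceptional m≡1 2ℓ≡0
    large-coincidence⇒Exceptional (two-jumps m≡1 Sign.- Sign.+ 2ℓ≡0) = l+l≡0⇒Exceptional m≡1 2ℓ≡0
    large-coincidence⇒Exceptional (two-jumps m≡1 Sign.- Sign.- 2ℓ≡-2) =
      l+l+2≡n⇒Exceptional m≡1 (∣-positive<2*⇒≡ (∣⇒∣ᵤ 2ℓ≡-2) (ℕ.m≤n⇒m≤o+n (l ℕ.+ l) (s≤s z≤n))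
        (ℕ.+-mono-≤-< l+l≤n (ℕ.<-trans 2<h h<n)))
    large-coincidence⇒Exceptional (two-cols m≡2 Sign.+ Sign.+ ℓ≡2) =
      case₅ m≡2 4<n (inj₂ (cong +_ (≡mod-unique l<n (ℕ.<-trans 2<h h<n) ℓ≡2)))
    large-coincidence⇒Exceptional (two-cols m≡2 Sign.+ Sign.- ℓ≡0) =
      case₅ m≡2 4<n (inj₁ (cong +_ (≡mod-unique l<n (ℕ.≤-<-trans z≤n 4<n) ℓ≡0)))
    large-coincidence⇒Exceptional (two-cols m≡2 Sign.- Sign.+ ℓ≡0) =
      case₅ m≡2 4<n (inj₁ (cong +_ (≡mod-unique l<n (ℕ.≤-<-trans z≤n 4<n) ℓ≡0)))
    -- Here `l + 2 = n` would force `h` to be at most 2.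
    large-coincidence⇒Exceptional (two-cols m≡2 Sign.- Sign.- ℓ≡-2) =
      contradiction (h≤c⇐l+c≡n 2 (∣-positive<2*⇒≡ (∣⇒∣ᵤ ℓ≡-2) (ℕ.m≤n⇒m≤o+n l (s≤s z≤n))
        (ℕ.+-mono-< l<n (ℕ.<-trans 2<h h<n)))) (ℕ.<⇒≱ 2<h)

  coincidence⇒Exceptional : Coincidence → Exceptional m n (+ l)
  coincidence⇒Exceptional c with n ℕ.≟ 4
  ... | yes n≡4 = case₁ n≡4
  ... | no  n≢4 = large-coincidence⇒Exceptional (ℕ.≤∧≢⇒< 4≤n (≢-sym n≢4)) c

-- Explicit short cycles.

module OneColumn (n l : ℕ) .{{_ : NonZero n}} (2∣n : + 2 ∣ + n) (l≡1 : + l ≡ 1ℤ [mod 2 ]) where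

  open Graph 1 n (+ l)
  open Bipartite 2∣n l≡1

  leap-odd : ∀ a b → + a ≡ 1ℤ [mod 2 ] → + b ≡ + a + + l [mod n ] → at 0F a ~ at 0F b
  leap-odd a b = leap 2∣n a b refl refl

  2+l-odd : + (2 ℕ.+ l) ≡ 1ℤ [mod 2 ]
  2+l-odd = subst (+ 2 ∣_) (ring (+ l)) (∣m∣n⇒∣m+n l≡1 (divides 1ℤ refl))
    where
    ring : ∀ x → (x - 1ℤ) + + 2 ≡ (+ 2 + x) - 1ℤ
    ring = solve-∀

  leap₁ : at 0F 1 ~ at 0F (1 ℕ.+ l)
  leap₁ = leap-odd 1 (1 ℕ.+ l) (divides 0ℤ refl) (divides 0ℤ (ℤ.+-inverseʳ (+ (1 ℕ.+ l))))

  leap₃ : at 0F 3 ~ at 0F (3 ℕ.+ l)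
  leap₃ = leap-odd 3 (3 ℕ.+ l) (divides 1ℤ refl) (divides 0ℤ (ℤ.+-inverseʳ (+ (3 ℕ.+ l))))

  apart : ∀ {a b} → a ℕ.< n → b ℕ.< n → a ≢ b → at 0F a ≢ at 0F b
  apart a<n b<n a≢b eq = mod-≢ a<n b<n a≢b (cong proj₂ eq)

  -- The cycle 1, `1 + l`, `2 + l`, `b`, whose two jumps advance by `2l` in total. It closes with
  -- `b = 2` if `2l = n` and with `b = 0` if `2l = n - 2`.
  two-jump-4-cycle : ∀ {b} → 2 ℕ.+ l ℕ.< n → b ℕ.< n → 1 ℕ.+ l ≢ b → at 0F b ~ at 0F 1 →
    + b ≡ + (2 ℕ.+ l) + + l [mod n ] → Cycle _~_ 4
  two-jump-4-cycle {b} 2+l<n b<n 1+l≢b b~1 b≡2+2l =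
    quadrilateral leap₁ (up (1 ℕ.+ l)) (leap-odd (2 ℕ.+ l) b 2+l-odd b≡2+2l) b~1
      (apart (ℕ.≤-<-trans (s≤s z≤n) 2+l<n) 2+l<n λ ())
      (apart (ℕ.<-trans ℕ.≤-refl 2+l<n) b<n 1+l≢b)

  -- The path 1, 2, 3 and its translate by `l`, joined by the jumps at 1 and 3. The bound on `3 + l`
  -- avoids wraparound, and `1 < l` keeps 2 and 3 apart from `1 + l` and `2 + l` respectively.
  hexagon₁ : 1 ℕ.< l → 3 ℕ.+ l ℕ.< n → Cycle _~_ 6
  hexagon₁ 1<l 3+l<n = hexagon
    (up 1) (up 2) leap₃ (down (2 ℕ.+ l)) (down (1 ℕ.+ l)) (symmetric (Edge 1 n (+ l)) leap₁)
    (apart 1<n 3<n λ ()) (apart 1<n 2+l<n λ ())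
    (apart 3<n 2+l<n (λ { refl → ℕ.<-irrefl refl 1<l }))
    (apart 2<n 3+l<n λ ()) (apart 2<n 1+l<n (λ { refl → ℕ.<-irrefl refl 1<l }))
    (apart 3+l<n 1+l<n (λ ()))
    where
    3<n : 3 ℕ.< n
    3<n = ℕ.≤-<-trans (ℕ.m≤m+n 3 l) 3+l<n
    2<n : 2 ℕ.< n
    2<n = ℕ.<-trans ℕ.≤-refl 3<n
    1<n : 1 ℕ.< n
    1<n = ℕ.<-trans ℕ.≤-refl 2<n
    2+l<n : 2 ℕ.+ l ℕ.< n
    2+l<n = ℕ.<-trans ℕ.≤-refl 3+l<n
    1+l<n : 1 ℕ.+ l ℕ.< n
    1+l<n = ℕ.<-trans ℕ.≤-refl 2+l<n

-- For `l = 1` the jump at the black vertex 1 is its upward vertical edge, which leaves only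
-- vertical neighbours.
l≢1 : ∀ {n l} .{{_ : NonZero n}} → + 2 ∣ + n → IsSimpleRegular (HTG 1 n (+ l)) 3 → l ≢ 1
l≢1 {n} 2∣n cubic refl = vertical-degree≢3 all-vertical (IsSimpleRegular.regular cubic (at 0F 1))
  where
  open Graph 1 n 1ℤ
  open Bipartite 2∣n (divides 0ℤ refl)
  all-vertical : ∀ {w} → at 0F 1 ~ w → ∃[ s ] Vertical s (at 0F 1) w
  all-vertical e with black-step e (mod-parity 2∣n 1)
  ... | inj₁ vert = vert
  ... | inj₂ (inner p) = contradiction p (last-column refl)
  ... | inj₂ (wrap {i′ = 0F} _ _ r) = Sign.+ , shift r

module ManyColumns (m n : ℕ) (ℓ : ℤ) .{{_ : NonZero n}} (2∣n : + 2 ∣ + n)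
  (ℓ≡m : ℓ ≡ + suc (suc m) [mod 2 ]) where

  open Graph (suc (suc m)) n ℓ
  open Bipartite 2∣n ℓ≡m

  across₀₁ : ∀ a → + a ≡ 1ℤ [mod 2 ] → at 0F a ~ at 1F a
  across₀₁ a = across 2∣n a refl

  -- The paths 1, 2, 3 in columns 0 and 1, joined by the flat edges at 1 and 3.
  hexagon₂ : 3 ℕ.< n → Cycle _~_ 6
  hexagon₂ 3<n = hexagon
    (up 1) (up 2) (across₀₁ 3 (divides 1ℤ refl)) (down 2) (down 1)
    (symmetric (Edge _ n ℓ) (across₀₁ 1 (divides 0ℤ refl)))
    (1≢3 ∘ cong proj₂) (λ ()) (λ ()) (λ ()) (λ ()) (≢-sym 1≢3 ∘ cong proj₂)
    where
    1≢3 : 1 mod n ≢ 3 mod n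
    1≢3 = mod-≢ (ℕ.<-trans (s≤s (s≤s z≤n)) 3<n) 3<n λ ()

-- The flat edge at 1 leads to column 1, and a jump ending at 2 in column 0 leads back. That jump
-- starts at 2 if `ℓ = 0` and at 0 if `ℓ = 2`, next to 1 either way.
two-column-4-cycle : ∀ {n ℓ} .{{_ : NonZero n}} → + 2 ∣ + n → ℓ ≡ + 0 ⊎ ℓ ≡ + 2 →
  Cycle (HTG 2 n ℓ) 4
two-column-4-cycle {n} 2∣n (inj₁ refl) =
  quadrilateral (across₀₁ 1 (divides 0ℤ refl)) (up 1)
    (leap 2∣n 2 2 refl refl (divides 0ℤ refl) (divides 0ℤ refl)) (down 1) (λ ()) (λ ())
  where
  open Graph 2 n 0ℤ
  open Bipartite 2∣n (divides (- 1ℤ) refl)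
  open ManyColumns 0 n 0ℤ 2∣n (divides (- 1ℤ) refl)
two-column-4-cycle {n} 2∣n (inj₂ refl) =
  quadrilateral (across₀₁ 1 (divides 0ℤ refl)) (down 0)
    (leap 2∣n 0 2 refl refl (divides (- 1ℤ) refl) (divides 0ℤ refl)) (down 1) (λ ()) (λ ())
  where
  open Graph 2 n (+ 2)
  open Bipartite 2∣n (divides 0ℤ refl)
  open ManyColumns 0 n (+ 2) 2∣n (divides 0ℤ refl)

column-4-cycle : ∀ {m ℓ} → ℓ ≡ + m [mod 2 ] → Fin m → Cycle (HTG m 4 ℓ) 4
column-4-cycle {m} {ℓ} ℓ≡m i = quadrilateral (up {i} 0) (up 1) (up 2)
  -- The column closes up from 3 to 0, as `0 - (3 + 1)` is -1 times 4.
  (fwd (vertical (divides (- 1ℤ) refl))) (λ ()) (λ ())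
  where
  open Graph m 4 ℓ
  open Bipartite (divides (+ 2) refl) ℓ≡m

-- Assembling the girth in both cases.

module _ {m h l : ℕ} (admissible : Admissible m (h ℕ.* 2) (+ l)) (l≤h : l ℕ.≤ h) where

  open Admissible admissible

  private
    n : ℕ
    n = h ℕ.* 2

    instance
      n-nonZero : NonZero n
      n-nonZero = ℕ.>-nonZero (ℕ.≤-trans (s≤s z≤n) 4≤n)

  2∣n : + 2 ∣ + n
  2∣n = divides (+ h) (ℤ.pos-* h 2)

  m≡1⇒l≢1 : m ≡ 1 → l ≢ 1
  m≡1⇒l≢1 refl = l≢1 2∣n cubic

  exceptional⇒4-cycle : Exceptional m n (+ l) → Cycle (HTG m n (+ l)) 4
  exceptional⇒4-cycle (case₁ n≡4) =
    subst (λ k → Cycle (HTG m k (+ l)) 4) (sym n≡4) (column-4-cycle parity (fromℕ< 1≤m))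
  exceptional⇒4-cycle (case₂ refl 4<n refl) =
    -- The path 1, 2, 3, 4 is closed by the jump between 1 and `1 + 3`.
    quadrilateral (up 1) (up 2) (up 3)
      (symmetric (Edge 1 n (+ 3)) leap₁)
      (apart (ℕ.<-trans (s≤s (s≤s z≤n)) 4<n) (ℕ.<-trans ℕ.≤-refl 4<n) λ ())
      (apart (ℕ.<-trans (s≤s (s≤s (s≤s z≤n))) 4<n) 4<n λ ())
    where
    open OneColumn n 3 2∣n parity
    open Graph 1 n (+ 3)
    open Bipartite 2∣n parity
  exceptional⇒4-cycle (case₃ refl 4<n _ ℓ≡n/2)
    with ℤ.+-injective (trans ℓ≡n/2 (cong +_ (m*n/n≡m h 2)))
  ... | refl = two-jump-4-cycle {2}
    (subst (2 ℕ.+ h ℕ.<_) (sym (*2≡+ h)) (ℕ.+-monoˡ-< h (4<h*2⇒2<h 4<n)))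
    (ℕ.<-trans (s≤s (s≤s (s≤s z≤n))) 4<n)
    (λ { refl → contradiction 4<n λ { (s≤s (s≤s ())) } })
    (down 1)
    (divides (- 1ℤ) (trans (ring (+ h)) (cong (λ x → - 1ℤ * x) (sym (ℤ.pos-* h 2)))))
    where
    open OneColumn n h 2∣n parity
    open Graph 1 n (+ h)
    ring : ∀ x → + 2 - (+ 2 + x + x) ≡ - 1ℤ * (x * + 2)
    ring = solve-∀
  exceptional⇒4-cycle (case₄ refl 4<n _ ℓ≡[n-2]/2) =
    -- Generalising over `h` permits matching it with `suc k`; then `(n ∸ 2) / 2` becomes `k`, and
    -- the second jump ends at `2 + 2k = n`, that is, at 0.
    case₄-cycle h 4<n (4<h*2⇒2<h 4<n) 2∣n parity (ℤ.+-injective ℓ≡[n-2]/2)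
    where
    case₄-cycle : ∀ h {l} → 4 ℕ.< h ℕ.* 2 → 2 ℕ.< h → + 2 ∣ + (h ℕ.* 2) → + l ≡ 1ℤ [mod 2 ] →
      l ≡ (h ℕ.* 2 ℕ.∸ 2) / 2 → Cycle (HTG 1 (h ℕ.* 2) (+ l)) 4
    case₄-cycle (suc k) 4<n (s≤s 2≤k) 2∣n k-odd l≡[n-2]/2 with trans l≡[n-2]/2 (m*n/n≡m k 2)
    ... | refl = two-jump-4-cycle {0}
      (subst (2 ℕ.+ k ℕ.<_) (cong (2 ℕ.+_) (sym (*2≡+ k))) (s≤s (s≤s (ℕ.+-monoˡ-≤ k (ℕ.<⇒≤ 2≤k)))))
      (s≤s z≤n) (λ ()) (up 0)
      (divides (- 1ℤ) (trans (ring (+ k)) (cong (λ x → - 1ℤ * (+ 2 + x)) (sym (ℤ.pos-* k 2)))))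
      where
      open OneColumn (suc k ℕ.* 2) k 2∣n k-odd
      open Graph 1 (suc k ℕ.* 2) (+ k)
      ring : ∀ x → 0ℤ - (+ 2 + x + x) ≡ - 1ℤ * (+ 2 + x * + 2)
      ring = solve-∀
  exceptional⇒4-cycle (case₅ refl _ ℓ≡) = two-column-4-cycle 2∣n ℓ≡

  4-cycle⇒exceptional : Cycle (HTG m n (+ l)) 4 → Exceptional m n (+ l)
  4-cycle⇒exceptional C =
    coincidence⇒Exceptional 4≤n parity l≤h m≡1⇒l≢1
      (Graph.Bipartite.4-cycle⇒coincidence m n (+ l) 2∣n parity C)

  ¬exceptional⇒6-cycle : ¬ Exceptional m n (+ l) → Cycle (HTG m n (+ l)) 6
  ¬exceptional⇒6-cycle ¬exceptional = by-columns m refl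
    where
    4<n : 4 ℕ.< n
    4<n = ℕ.≤∧≢⇒< 4≤n λ 4≡n → ¬exceptional (case₁ (sym 4≡n))
    -- Both `3 < h` and `l ≤ h` hold, and `n = h + h`.
    5≤l⇒3+l<n : 5 ℕ.≤ l → 3 ℕ.+ l ℕ.< n
    5≤l⇒3+l<n 5≤l = subst (3 ℕ.+ l ℕ.<_) (sym (*2≡+ h))
      (ℕ.+-mono-<-≤ (ℕ.≤-trans (ℕ.<⇒≤ 5≤l) l≤h) l≤h)
    by-columns : ∀ m′ → m′ ≡ m → Cycle (HTG m n (+ l)) 6
    by-columns 0 refl = contradiction 1≤m λ ()
    by-columns (suc (suc m′)) refl =
      ManyColumns.hexagon₂ m′ n (+ l) 2∣n parity (ℕ.<-trans ℕ.≤-refl 4<n)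
    by-columns 1 refl with odd parity
    -- For one column `l` is odd: 1 contradicts cubicity, 3 is exceptional, and from 5 on the
    -- translated hexagon fits.
    ... | 0           , l≡1  = contradiction l≡1 (m≡1⇒l≢1 refl)
    ... | 1           , l≡3  = contradiction (case₂ refl 4<n (cong +_ l≡3)) ¬exceptional
    ... | suc (suc q) , refl =
      OneColumn.hexagon₁ n l 2∣n parity (s≤s (s≤s z≤n)) (5≤l⇒3+l<n (ℕ.m≤m+n 5 (q ℕ.* 2)))

theorem5p1 : ∀ (m n : ℕ) (ℓ : ℤ) → Admissible m n ℓ → NormalForm n ℓ →
    (Exceptional m n ℓ → HasGirth (HTG m n ℓ) 4) ×
    (¬ Exceptional m n ℓ → HasGirth (HTG m n ℓ) 6)
theorem5p1 m n (+ l) admissible (_ , +≤+ l≤n/2)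
  with m%n≡0⇒n∣m n 2 (Admissible.n-even admissible)
... | ℕ∣.divides h refl =
    (λ exceptional → record
      { attained = exceptional⇒4-cycle admissible l≤h exceptional
      ; shortest = girth≥4 })
  , (λ ¬exceptional → record
      { attained = ¬exceptional⇒6-cycle admissible l≤h ¬exceptional
      ; shortest = girth≥6 (¬exceptional ∘ 4-cycle⇒exceptional admissible l≤h) })
  where
  l≤h : l ℕ.≤ h
  l≤h = subst (l ℕ.≤_) (m*n/n≡m h 2) l≤n/2
  open Graph.Bipartite m (h ℕ.* 2) (+ l) (2∣n admissible l≤h) (Admissible.parity admissible)
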